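{- The variety of semilinear idempotent residuated lattices is not locally finite.
   Context: A residuated lattice is an algebra $\mathbf A=\langle A,\wedge,\vee,\cdot,\backslash,/,\mathrm e\rangle$ such that $\langle A,\wedge,\vee\rangle$ is a lattice, $\langle A,\cdot,\mathrm e\rangle$ is a monoid, and for all $a,b,c\in A$: $b\le a\backslash c\iff a\cdot b\le c\iff a\le c/b$. It is idempotent if $aa=a$ for all $a$. The variety of semilinear idempotent residuated lattices is the variety generated by all totally ordered idempotent residuated lattices. A variety is locally finite if each of its finitely generated members is finite. -}

module Defs where

open import Algebra.Core using (Op₂)
open import Algebra.Lattice.Bundles using (Lattice)
import Algebra.Definitions as AlgebraDefinitions
import Algebra.Lattice.Structures as LatticeStructures
import Algebra.Structures as AlgebraStructures
open import Data.Fin.Base using (Fin)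
open import Data.Nat.Base using (ℕ)
open import Data.Product.Base using (_×_; _,_; ∃; ∃-syntax)
open import Function.Bundles using (_⇔_; Surjection)
open import Level using (Level; _⊔_) renaming (suc to lsuc)
open import Relation.Binary.Bundles using (Setoid)
open import Relation.Binary.Core using (Rel)
import Relation.Binary.Construct.NaturalOrder.Left as NaturalOrder
open import Relation.Binary.Definitions using (Total)
open import Relation.Binary.PropositionalEquality.Properties using (setoid)

-- The underlying set is a setoid.  As usual in the library, the order is
-- a ≤ b  iff  a ≈ a ∧ b.  That _\\_ and _//_ respect _≈_ is not required
-- separately: it follows from residuation, since a residual is determined
-- by the elements below it.
record ResiduatedLattice (c ℓ : Level) : Set (lsuc (c ⊔ ℓ)) where
  infixr 8 _∙_
  infix  8 _\\_ _//_
  infixr 7 _∧_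
  infixr 6 _∨_
  infix  4 _≈_
  field
    Carrier : Set c
    _≈_     : Rel Carrier ℓ
    _∧_     : Op₂ Carrier
    _∨_     : Op₂ Carrier
    _∙_     : Op₂ Carrier
    _\\_    : Op₂ Carrier
    _//_    : Op₂ Carrier
    e       : Carrier

  open AlgebraDefinitions _≈_ using (Congruent₂; Associative; Identity)
  open AlgebraStructures _≈_ using (IsMonoid)
  open LatticeStructures _≈_ using (IsLattice)
  open NaturalOrder _≈_ _∧_ public using (_≤_)

  field
    isLattice  : IsLattice _∨_ _∧_
    ∙-cong     : Congruent₂ _∙_
    ∙-assoc    : Associative _∙_
    ∙-identity : Identity e _∙_
    residualˡ  : ∀ a b c → (b ≤ a \\ c) ⇔ (a ∙ b ≤ c)
    residualʳ  : ∀ a b c → (a ∙ b ≤ c) ⇔ (a ≤ c // b)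

  lattice : Lattice c ℓ
  lattice = record { isLattice = isLattice }

  isMonoid : IsMonoid _∙_ e
  isMonoid = record
    { isSemigroup = record
      { isMagma = record
        { isEquivalence = IsLattice.isEquivalence isLattice
        ; ∙-cong        = ∙-cong
        }
      ; assoc = ∙-assoc
      }
    ; identity = ∙-identity
    }

  carrierSetoid : Setoid c ℓ
  carrierSetoid = record { isEquivalence = IsLattice.isEquivalence isLattice }

Class : (c ℓ p : Level) → Set (lsuc (c ⊔ ℓ ⊔ p))
Class c ℓ p = ResiduatedLattice c ℓ → Set p

data Term : Set where
  var                              : ℕ → Term
  _`∧_ _`∨_ _`∙_ _`\\_ _`//_       : Term → Term → Term
  `e                               : Term

module _ {c ℓ : Level} (A : ResiduatedLattice c ℓ) where
  open ResiduatedLattice A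

  ⟦_⟧ : Term → (ℕ → Carrier) → Carrier
  ⟦ var i   ⟧ ρ = ρ i
  ⟦ s `∧ t  ⟧ ρ = ⟦ s ⟧ ρ ∧ ⟦ t ⟧ ρ
  ⟦ s `∨ t  ⟧ ρ = ⟦ s ⟧ ρ ∨ ⟦ t ⟧ ρ
  ⟦ s `∙ t  ⟧ ρ = ⟦ s ⟧ ρ ∙ ⟦ t ⟧ ρ
  ⟦ s `\\ t ⟧ ρ = ⟦ s ⟧ ρ \\ ⟦ t ⟧ ρ
  ⟦ s `// t ⟧ ρ = ⟦ s ⟧ ρ // ⟦ t ⟧ ρ
  ⟦ `e      ⟧ ρ = e

Equation : Set
Equation = Term × Term

infix 4 _⊨_

_⊨_ : {c ℓ : Level} → ResiduatedLattice c ℓ → Equation → Set (c ⊔ ℓ)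
A ⊨ (s , t) = ∀ ρ → ResiduatedLattice._≈_ A (⟦_⟧ A s ρ) (⟦_⟧ A t ρ)

-- Varieties are equational classes, so the least variety containing K
-- consists of the models of all equations valid throughout K.  Residuated
-- lattices themselves form a variety, so nothing is lost by taking models
-- among residuated lattices only.
VarietyGeneratedBy : {c ℓ p : Level} → Class c ℓ p → Class c ℓ (lsuc (c ⊔ ℓ) ⊔ p)
VarietyGeneratedBy K A = ∀ ε → (∀ B → K B → B ⊨ ε) → A ⊨ ε

IsIdempotent : {c ℓ : Level} → Class c ℓ (c ⊔ ℓ)
IsIdempotent A = AlgebraDefinitions.Idempotent _≈_ _∙_
  where open ResiduatedLattice A

IsTotallyOrdered : {c ℓ : Level} → Class c ℓ (c ⊔ ℓ)
IsTotallyOrdered A = Total (ResiduatedLattice._≤_ A)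

SemilinearIdempotent : (c ℓ : Level) → Class c ℓ (lsuc (c ⊔ ℓ))
SemilinearIdempotent c ℓ =
  VarietyGeneratedBy {c} {ℓ} (λ A → IsTotallyOrdered A × IsIdempotent A)

module _ {c ℓ : Level} (A : ResiduatedLattice c ℓ) where
  open ResiduatedLattice A

  -- The subalgebra generated by the family g, as a subset closed under _≈_.
  data Generated {n : ℕ} (g : Fin n → Carrier) : Carrier → Set (c ⊔ ℓ) where
    gen  : ∀ i → Generated g (g i)
    resp : ∀ {x y} → x ≈ y → Generated g x → Generated g y
    ∧-cl : ∀ {x y} → Generated g x → Generated g y → Generated g (x ∧ y)
    ∨-cl : ∀ {x y} → Generated g x → Generated g y → Generated g (x ∨ y)
    ∙-cl : ∀ {x y} → Generated g x → Generated g y → Generated g (x ∙ y)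
    \\-cl : ∀ {x y} → Generated g x → Generated g y → Generated g (x \\ y)
    //-cl : ∀ {x y} → Generated g x → Generated g y → Generated g (x // y)
    e-cl : Generated g e

  FinitelyGenerated : Set (c ⊔ ℓ)
  FinitelyGenerated = ∃[ n ] ∃ λ (g : Fin n → Carrier) → ∀ x → Generated g x

  -- A finite list exhausts the carrier up to _≈_, possibly with repetitions;
  -- requiring a bijection would also ask for decidability of _≈_.
  Finite : Set (c ⊔ ℓ)
  Finite = ∃[ n ] Surjection (setoid (Fin n)) carrierSetoid

LocallyFinite : {c ℓ p : Level} → Class c ℓ p → Set (lsuc (c ⊔ ℓ) ⊔ p)
LocallyFinite V = ∀ A → V A → FinitelyGenerated A → Finite A

{-# OPTIONS --safe #-}
-- A single infinite, one-generated, totally ordered example suffices.  Take ℤ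
-- with its usual order, where a ⊙ b is the argument of larger absolute value,
-- the left one in case of a tie; the unit is 0.  All residuals exist, and
--   + (n + 1) \\ 0 = - (n + 2),   - n \\ 0 = + n,   0 // + (n + 1) = - (n + 1),
-- so + 1 generates everything: its double residuals climb through the
-- positive integers.
module Submission where

open import Defs
open import Level using (Level; Lift; lift; lower; _⊔_; 0ℓ)
open import Relation.Nullary.Negation using (¬_; contradiction)

import Algebra.Definitions as AlgebraDefinitions
open import Algebra.Lattice.Structures using (IsLattice)
open import Data.Fin.Base using (Fin; zero)
open import Data.Fin.Properties using (ℕ→Fin-notInjective)
open import Data.Integer.Base
  using (ℤ; +_; -[1+_]; -_; ∣_∣; pred; _⊓_; _≤_; _<_; +≤+; -≤+; -≤-; +<+)
  renaming (_⊔_ to _⊔ℤ_)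
import Data.Integer.Properties as ℤ
open import Data.Nat.Base as ℕ using (ℕ; zero; suc; z≤n; s≤s)
import Data.Nat.Properties as ℕ
open import Data.Product.Base using (_,_; proj₁; proj₂)
open import Data.Sum.Base using (_⊎_; inj₁; inj₂; [_,_]′)
import Data.Sum.Base as Sum
open import Function.Base using (const; id; _∘_)
open import Function.Bundles using (_⇔_; mk⇔; Equivalence; Surjection)
open import Relation.Binary.PropositionalEquality
  using (_≡_; refl; sym; trans; cong; cong₂; subst)
open import Relation.Nullary.Decidable using (yes; no)

∣i∣≤n⇒-n≤i : ∀ i {n} → ∣ i ∣ ℕ.≤ n → - (+ n) ≤ i
∣i∣≤n⇒-n≤i (+ m)            _         = ℤ.≤-trans ℤ.neg-≤-pos (+≤+ z≤n)
∣i∣≤n⇒-n≤i -[1+ m ] {suc n} (s≤s m≤n) = -≤- m≤n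

∣i∣≤n⇒i≤n : ∀ i {n} → ∣ i ∣ ℕ.≤ n → i ≤ + n
∣i∣≤n⇒i≤n (+ m)    m≤n = +≤+ m≤n
∣i∣≤n⇒i≤n -[1+ m ] _   = -≤+

-- Serves the residuation proofs, where `i` is the argument that wins the product and `n` bounds the
-- absolute value of the loser: a negative winner lies below the loser, a positive one at or above
-- it.
n≤∣i∣⇒i≤-n⊎n≤i : ∀ i {n} → n ℕ.≤ ∣ i ∣ → i ≤ - (+ n) ⊎ + n ≤ i
n≤∣i∣⇒i≤-n⊎n≤i (+ m)            n≤m       = inj₂ (+≤+ n≤m)
n≤∣i∣⇒i≤-n⊎n≤i -[1+ m ] {zero}  _         = inj₁ -≤+
n≤∣i∣⇒i≤-n⊎n≤i -[1+ m ] {suc n} (s≤s n≤m) = inj₁ (-≤- n≤m)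

i≤∣i∣ : ∀ i → i ≤ + ∣ i ∣
i≤∣i∣ i = ∣i∣≤n⇒i≤n i ℕ.≤-refl

-∣i∣≤i : ∀ i → - (+ ∣ i ∣) ≤ i
-∣i∣≤i i = ∣i∣≤n⇒-n≤i i ℕ.≤-refl

infixr 7 _⊙_ _⇨_ _⇦_

_⊙_ : ℤ → ℤ → ℤ
a ⊙ b with ∣ a ∣ ℕ.<? ∣ b ∣
... | yes _ = b
... | no  _ = a

-- The greatest `b` with `a ⊙ b ≤ c`. If `a ≤ c`, every `b` with `∣ b ∣ ≤ ∣ a ∣` qualifies;
-- otherwise `b` must override `a` from the negative side, and since `a` wins ties this costs the
-- extra 1.
_⇨_ : ℤ → ℤ → ℤ
a ⇨ c with a ℤ.≤? c
... | yes _ = c ⊔ℤ + ∣ a ∣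
... | no  _ = c ⊓ -[1+ ∣ a ∣ ]

-- Now the unknown left factor wins ties, so the bounds are those of `_⇨_` with `∣ b ∣ - 1` for
-- `∣ a ∣`. At `b = + 0` the `pred` gives -1, which the join absorbs because `c` is then
-- nonnegative.
_⇦_ : ℤ → ℤ → ℤ
c ⇦ b with b ℤ.≤? c
... | yes _ = c ⊔ℤ pred (+ ∣ b ∣)
... | no  _ = c ⊓ - (+ ∣ b ∣)

∣a∣<∣b∣⇒a⊙b≡b : ∀ a b → ∣ a ∣ ℕ.< ∣ b ∣ → a ⊙ b ≡ b
∣a∣<∣b∣⇒a⊙b≡b a b a<b with ∣ a ∣ ℕ.<? ∣ b ∣
... | yes _  = refl
... | no a≮b = contradiction a<b a≮b

∣b∣≤∣a∣⇒a⊙b≡a : ∀ a b → ∣ b ∣ ℕ.≤ ∣ a ∣ → a ⊙ b ≡ a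
∣b∣≤∣a∣⇒a⊙b≡a a b b≤a with ∣ a ∣ ℕ.<? ∣ b ∣
... | yes a<b = contradiction b≤a (ℕ.<⇒≱ a<b)
... | no _    = refl

open AlgebraDefinitions {A = ℤ} _≡_ using (Associative; Identity; Idempotent)

⊙-idem : Idempotent _⊙_
⊙-idem a = ∣b∣≤∣a∣⇒a⊙b≡a a a ℕ.≤-refl

⊙-identity : Identity (+ 0) _⊙_
⊙-identity = identityˡ , λ a → ∣b∣≤∣a∣⇒a⊙b≡a a (+ 0) z≤n
  where
  identityˡ : ∀ a → + 0 ⊙ a ≡ a
  identityˡ (+ zero)    = refl
  identityˡ (+ (suc n)) = refl
  identityˡ -[1+ n ]    = refl

-- Both bracketings select the leftmost argument of maximal absolute value.
⊙-assoc : Associative _⊙_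
⊙-assoc a b c = helper (ℕ.<-≤-connex ∣ a ∣ ∣ b ∣) (ℕ.<-≤-connex ∣ b ∣ ∣ c ∣)
  where
  helper : ∣ a ∣ ℕ.< ∣ b ∣ ⊎ ∣ b ∣ ℕ.≤ ∣ a ∣ →
           ∣ b ∣ ℕ.< ∣ c ∣ ⊎ ∣ c ∣ ℕ.≤ ∣ b ∣ →
           (a ⊙ b) ⊙ c ≡ a ⊙ (b ⊙ c)
  helper (inj₁ a<b) (inj₁ b<c)
    rewrite ∣a∣<∣b∣⇒a⊙b≡b a b a<b | ∣a∣<∣b∣⇒a⊙b≡b b c b<c
    = sym (∣a∣<∣b∣⇒a⊙b≡b a c (ℕ.<-trans a<b b<c))
  helper (inj₁ a<b) (inj₂ c≤b)
    rewrite ∣a∣<∣b∣⇒a⊙b≡b a b a<b | ∣b∣≤∣a∣⇒a⊙b≡a b c c≤b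
    = sym (∣a∣<∣b∣⇒a⊙b≡b a b a<b)
  -- `b` loses both products, so each side becomes `a ⊙ c`.
  helper (inj₂ b≤a) (inj₁ b<c)
    rewrite ∣b∣≤∣a∣⇒a⊙b≡a a b b≤a | ∣a∣<∣b∣⇒a⊙b≡b b c b<c
    = refl
  helper (inj₂ b≤a) (inj₂ c≤b)
    rewrite ∣b∣≤∣a∣⇒a⊙b≡a a b b≤a | ∣b∣≤∣a∣⇒a⊙b≡a b c c≤b
    = trans (∣b∣≤∣a∣⇒a⊙b≡a a c (ℕ.≤-trans c≤b b≤a))
            (sym (∣b∣≤∣a∣⇒a⊙b≡a a b b≤a))

i≤j⊔k⇒i≤j⊎i≤k : ∀ {i} j k → i ≤ j ⊔ℤ k → i ≤ j ⊎ i ≤ k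
i≤j⊔k⇒i≤j⊎i≤k {i} j k i≤j⊔k =
  Sum.map (λ eq → subst (i ≤_) eq i≤j⊔k) (λ eq → subst (i ≤_) eq i≤j⊔k) (ℤ.⊔-sel j k)

⊙-residualˡ : ∀ a b c → (b ≤ a ⇨ c) ⇔ (a ⊙ b ≤ c)
⊙-residualˡ a b c with a ℤ.≤? c | ∣ a ∣ ℕ.<? ∣ b ∣
... | yes a≤c | yes a<b = mk⇔
  ([ id , b≤∣a∣⇒b≤c ]′ ∘ i≤j⊔k⇒i≤j⊎i≤k c _)
  (ℤ.i≤j⇒i≤j⊔k _)
  where
  b≤∣a∣⇒b≤c : b ≤ + ∣ a ∣ → b ≤ c
  -- A `b` that overrides `a` without exceeding `+ ∣ a ∣` must be negative, hence below `a`.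
  b≤∣a∣⇒b≤c b≤∣a∣ with n≤∣i∣⇒i≤-n⊎n≤i b a<b
  ... | inj₁ b≤-a = ℤ.≤-trans b≤-a (ℤ.≤-trans (∣i∣≤n⇒-n≤i a (ℕ.n≤1+n _)) a≤c)
  ... | inj₂ a≤b  = contradiction (ℤ.drop‿+≤+ (ℤ.≤-trans a≤b b≤∣a∣)) ℕ.1+n≰n
... | yes a≤c | no a≮b = mk⇔
  (const a≤c)
  (const (ℤ.i≤j⇒i≤k⊔j c (∣i∣≤n⇒i≤n b (ℕ.≮⇒≥ a≮b))))
... | no a≰c | yes a<b = mk⇔
  (ℤ.i≤j⊓k⇒i≤j c _)
  (λ b≤c → ℤ.⊓-glb b≤c
    ([ id
     , (λ a<b → contradiction
         (ℤ.≤-trans (ℤ.≤-trans (∣i∣≤n⇒i≤n a (ℕ.n≤1+n _)) a<b) b≤c) a≰c)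
     ]′ (n≤∣i∣⇒i≤-n⊎n≤i b a<b)))
-- Both sides fail: `∣ b ∣ ≤ ∣ a ∣` keeps `b` above `-[1+ ∣ a ∣ ]`.
... | no a≰c | no a≮b = mk⇔
  (λ b≤ → contradiction
    (ℤ.drop‿+≤+ (ℤ.neg-cancel-≤ {+ ∣ a ∣} {+ suc ∣ a ∣}
      (ℤ.≤-trans (∣i∣≤n⇒-n≤i b (ℕ.≮⇒≥ a≮b)) (ℤ.i≤j⊓k⇒i≤k c _ b≤))))
    ℕ.1+n≰n)
  (λ a≤c → contradiction a≤c a≰c)

⊙-residualʳ : ∀ a b c → (a ⊙ b ≤ c) ⇔ (a ≤ c ⇦ b)
⊙-residualʳ a b c with b ℤ.≤? c | ∣ a ∣ ℕ.<? ∣ b ∣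
... | yes b≤c | yes a<b = mk⇔
  (const (ℤ.i≤j⇒i≤k⊔j c
    (ℤ.i<j⇒i≤pred[j] (ℤ.≤-<-trans (i≤∣i∣ a) (+<+ a<b)))))
  (const b≤c)
... | yes b≤c | no a≮b = mk⇔
  (ℤ.i≤j⇒i≤j⊔k _)
  ([ id , a<∣b∣⇒a≤c ∘ ℤ.i≤pred[j]⇒i<j ]′ ∘ i≤j⊔k⇒i≤j⊎i≤k c _)
  where
  a<∣b∣⇒a≤c : a < + ∣ b ∣ → a ≤ c
  a<∣b∣⇒a≤c a<∣b∣ with n≤∣i∣⇒i≤-n⊎n≤i a (ℕ.≮⇒≥ a≮b)
  ... | inj₁ a≤-b  = ℤ.≤-trans a≤-b (ℤ.≤-trans (-∣i∣≤i b) b≤c)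
  ... | inj₂ ∣b∣≤a = contradiction ∣b∣≤a (ℤ.<⇒≱ a<∣b∣)
... | no b≰c | yes a<b = mk⇔
  (λ b≤c → contradiction b≤c b≰c)
  -- From `- ∣ a ∣ ≤ a ≤ - ∣ b ∣` it would follow that `∣ b ∣ ≤ ∣ a ∣`.
  (λ a≤ → contradiction
    (ℤ.neg-cancel-≤ (ℤ.≤-trans (-∣i∣≤i a) (ℤ.i≤j⊓k⇒i≤k c _ a≤)))
    (ℤ.<⇒≱ (+<+ a<b)))
... | no b≰c | no a≮b = mk⇔
  (λ a≤c → ℤ.⊓-glb a≤c
    ([ id
     , (λ ∣b∣≤a → contradiction (ℤ.≤-trans (i≤∣i∣ b) (ℤ.≤-trans ∣b∣≤a a≤c)) b≰c)
     ]′ (n≤∣i∣⇒i≤-n⊎n≤i a (ℕ.≮⇒≥ a≮b))))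
  (ℤ.i≤j⊓k⇒i≤j c _)

ℤ-residuatedLattice : ResiduatedLattice 0ℓ 0ℓ
ℤ-residuatedLattice = record
  { Carrier    = ℤ
  ; _≈_        = _≡_
  ; _∧_        = _⊓_
  ; _∨_        = _⊔ℤ_
  ; _∙_        = _⊙_
  ; _\\_       = _⇨_
  ; _//_       = _⇦_
  ; e          = + 0
  ; isLattice  = ℤ.⊔-⊓-isLattice
  ; ∙-cong     = cong₂ _⊙_
  ; ∙-assoc    = ⊙-assoc
  ; ∙-identity = ⊙-identity
  ; residualˡ  = λ a b c → mk⇔
      (fromOrder ∘ Equivalence.to (⊙-residualˡ a b c) ∘ toOrder)
      (fromOrder ∘ Equivalence.from (⊙-residualˡ a b c) ∘ toOrder)
  ; residualʳ  = λ a b c → mk⇔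
      (fromOrder ∘ Equivalence.to (⊙-residualʳ a b c) ∘ toOrder)
      (fromOrder ∘ Equivalence.from (⊙-residualʳ a b c) ∘ toOrder)
  }
  where
  fromOrder : ∀ {i j} → i ≤ j → i ≡ i ⊓ j
  fromOrder = sym ∘ ℤ.i≤j⇒i⊓j≡i

  toOrder : ∀ {i j} → i ≡ i ⊓ j → i ≤ j
  toOrder = ℤ.i⊓j≡i⇒i≤j ∘ sym

-- The theorem ranges over all levels, while ℤ lives at `0ℓ`; from there the lift lands exactly in
-- `c` and `ℓ`.
liftResiduatedLattice : ∀ {a b} c ℓ → ResiduatedLattice a b →
                        ResiduatedLattice (a ⊔ c) (b ⊔ ℓ)
liftResiduatedLattice c ℓ A = record
  { Carrier    = Lift c Carrier
  ; _≈_        = λ x y → Lift ℓ (lower x ≈ lower y)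
  ; _∧_        = λ x y → lift (lower x ∧ lower y)
  ; _∨_        = λ x y → lift (lower x ∨ lower y)
  ; _∙_        = λ x y → lift (lower x ∙ lower y)
  ; _\\_       = λ x y → lift (lower x \\ lower y)
  ; _//_       = λ x y → lift (lower x // lower y)
  ; e          = lift e
  ; isLattice  = record
    { isEquivalence = record
      { refl  = lift L.refl
      ; sym   = λ p → lift (L.sym (lower p))
      ; trans = λ p q → lift (L.trans (lower p) (lower q))
      }
    ; ∨-comm     = λ x y → lift (L.∨-comm (lower x) (lower y))
    ; ∨-assoc    = λ x y z → lift (L.∨-assoc (lower x) (lower y) (lower z))
    ; ∨-cong     = λ p q → lift (L.∨-cong (lower p) (lower q))
    ; ∧-comm     = λ x y → lift (L.∧-comm (lower x) (lower y))
    ; ∧-assoc    = λ x y z → lift (L.∧-assoc (lower x) (lower y) (lower z))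
    ; ∧-cong     = λ p q → lift (L.∧-cong (lower p) (lower q))
    ; absorptive = (λ x y → lift (L.∨-absorbs-∧ (lower x) (lower y)))
                 , (λ x y → lift (L.∧-absorbs-∨ (lower x) (lower y)))
    }
  ; ∙-cong     = λ p q → lift (∙-cong (lower p) (lower q))
  ; ∙-assoc    = λ x y z → lift (∙-assoc (lower x) (lower y) (lower z))
  ; ∙-identity = (λ x → lift (∙-identityˡ (lower x)))
               , (λ x → lift (∙-identityʳ (lower x)))
  ; residualˡ  = λ x y z → lift-⇔ (residualˡ (lower x) (lower y) (lower z))
  ; residualʳ  = λ x y z → lift-⇔ (residualʳ (lower x) (lower y) (lower z))
  }
  where
  open ResiduatedLattice A
  module L = IsLattice isLattice
  ∙-identityˡ = proj₁ ∙-identity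
  ∙-identityʳ = proj₂ ∙-identity
  lift-⇔ : ∀ {p q} {P : Set p} {Q : Set q} → P ⇔ Q → Lift ℓ P ⇔ Lift ℓ Q
  lift-⇔ P⇔Q = mk⇔ (λ p → lift (Equivalence.to P⇔Q (lower p)))
                   (λ q → lift (Equivalence.from P⇔Q (lower q)))

module _ (c ℓ : Level) where

  private
    ℤ↑ : ResiduatedLattice c ℓ
    ℤ↑ = liftResiduatedLattice c ℓ ℤ-residuatedLattice

  -- `ℤ↑` is itself one of the generating chains.
  ℤ↑-semilinearIdempotent : SemilinearIdempotent c ℓ ℤ↑
  ℤ↑-semilinearIdempotent _ valid = valid ℤ↑
    ( (λ x y → Sum.map (lift ∘ sym ∘ ℤ.i≤j⇒i⊓j≡i) (lift ∘ sym ∘ ℤ.i≤j⇒i⊓j≡i)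
                       (ℤ.≤-total (lower x) (lower y)))
    , (λ x → lift (⊙-idem (lower x))))

  ℤ↑-finitelyGenerated : FinitelyGenerated ℤ↑
  ℤ↑-finitelyGenerated = 1 , const (lift (+ 1)) , λ x → generates (lower x)
    where
    Gen : ℤ → Set (c ⊔ ℓ)
    Gen i = Generated ℤ↑ (const {B = Fin 1} (lift (+ 1))) (lift i)

    positive : ∀ n → Gen (+ suc n)
    positive zero    = gen zero
    -- The inner residual computes to `- (n + 2)`, gaining 1 in absolute value; the outer one only
    -- flips the sign.
    positive (suc n) = \\-cl (\\-cl (positive n) e-cl) e-cl

    generates : ∀ i → Gen i
    generates (+ zero)    = e-cl
    generates (+ (suc n)) = positive n
    -- Residuals on this side gain nothing in absolute value, so -1 is reached too.
    generates -[1+ n ]    = //-cl e-cl (positive n)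

  -- Choosing a preimage of each `+ k` would inject ℕ into `Fin n`, since `to` recovers `+ k` from
  -- the chosen index.
  ℤ↑-infinite : ¬ Finite ℤ↑
  ℤ↑-infinite (n , s) = ℕ→Fin-notInjective (λ k → to⁻ (lift (+ k)))
    (λ {j} {k} eq → ℤ.+-injective (trans (sym (lower (to∘to⁻ (lift (+ j)))))
      (trans (cong (lower ∘ to) eq) (lower (to∘to⁻ (lift (+ k)))))))
    where open Surjection s using (to; to⁻; to∘to⁻)

proposition4p6 : ∀ (c ℓ : Level) → ¬ LocallyFinite (SemilinearIdempotent c ℓ)
proposition4p6 c ℓ locallyFinite =
  ℤ↑-infinite c ℓ
    (locallyFinite _ (ℤ↑-semilinearIdempotent c ℓ) (ℤ↑-finitelyGenerated c ℓ))
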